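{- Let $G$ be a graph on $n\ge 3$ vertices, with an edge-colouring using exactly $r$ colours. Let $f:\binom{V(G)}{2}\to\mathbb{Z}_{\ge 0}$ be such that for all distinct $u,v\in V(G)$, there are $f(u,v)$ disjoint monochromatic super-paths connecting $u$ and $v$. Then \[ e(G)\ge\left\lceil\frac{w(f)}{n-2}\right\rceil+r-1. \]
   Context: All graphs are finite, simple and undirected. A super-path is a path of length at least two. Paths are called disjoint if they are internally vertex-disjoint. An edge-coloured path is monochromatic if all its edges have the same colour. For $f:\binom{V(G)}{2}\to\mathbb{Z}_{\ge 0}$ write $f(u,v)=f(\{u,v\})$, and define the weight $w(f)=\sum_{\{u,v\}\in\binom{V(G)}{2}} f(u,v)$. -}

module Defs where

open import Data.Bool using (Bool; T)
open import Data.Bool.Properties using (T?)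
open import Data.Fin using (Fin; _<?_)
open import Data.List using (List; []; _∷_; allFin; cartesianProduct; filter; length; map; sum)
open import Data.List.Relation.Binary.Disjoint.Propositional using (Disjoint)
open import Data.List.Relation.Unary.AllPairs using (AllPairs)
open import Data.List.Relation.Unary.Unique.Propositional using (Unique)
open import Data.Nat using (ℕ; suc; _≤_; _≥_; _∸_; NonZero; s≤s)
open import Data.Product using (Σ; ∃; _×_; _,_; uncurry)
open import Relation.Binary.PropositionalEquality using (_≡_; _≢_)
open import Relation.Nullary using (¬_)

-- Finite simple graphs on the vertex set Fin n.  Adjacency is Bool-valued, so
-- that T (adj u v) has at most one proof and an edge is counted only once.
record Graph (n : ℕ) : Set where
  field
    adj     : Fin n → Fin n → Bool
    adj-sym : ∀ u v → adj u v ≡ adj v u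
    irrefl  : ∀ v → ¬ T (adj v v)

-- Each 2-subset {u,v} of Fin n is represented once, as (u , v) with u < v.
pairs : ∀ n → List (Fin n × Fin n)
pairs n = filter (uncurry _<?_) (cartesianProduct (allFin n) (allFin n))

edgeCount : ∀ {n} → Graph n → ℕ
edgeCount {n} G = length (filter (λ p → T? (uncurry adj p)) (pairs n))
  where open Graph G

-- Functions on 2-subsets of Fin n, as symmetric functions of two vertices.
-- Diagonal values carry no meaning and are never used.
record PairFunction (n : ℕ) : Set where
  field
    _⟨_,_⟩ : Fin n → Fin n → ℕ
    symm   : ∀ u v → _⟨_,_⟩ u v ≡ _⟨_,_⟩ v u

open PairFunction public using (_⟨_,_⟩)

weight : ∀ {n} → PairFunction n → ℕ
weight {n} f = sum (map (uncurry (f ⟨_,_⟩)) (pairs n))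

-- Edge-colourings using exactly r colours: every colour occurs on some edge.
record Colouring {n : ℕ} (G : Graph n) (r : ℕ) : Set where
  open Graph G
  field
    colour     : ∀ u v → T (adj u v) → Fin r
    colour-sym : ∀ u v (e : T (adj u v)) (e′ : T (adj v u)) → colour u v e ≡ colour v u e′
    onto       : ∀ (c : Fin r) → ∃ λ u → ∃ λ v → Σ (T (adj u v)) λ e → colour u v e ≡ c

data Walk {n : ℕ} (G : Graph n) : Fin n → Fin n → Set where
  nil  : ∀ {u} → Walk G u u
  cons : ∀ {u w v} → T (Graph.adj G u w) → Walk G w v → Walk G u v

module _ {n : ℕ} {G : Graph n} where

  vertices : ∀ {u v} → Walk G u v → List (Fin n)
  vertices {u} nil        = u ∷ []
  vertices {u} (cons _ p) = u ∷ vertices p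

  -- All vertices except the two ends.
  interior : ∀ {u v} → Walk G u v → List (Fin n)
  interior nil                            = []
  interior (cons _ nil)                   = []
  interior (cons {w = w} _ p@(cons _ _)) = w ∷ interior p

  walkLength : ∀ {u v} → Walk G u v → ℕ
  walkLength nil        = 0
  walkLength (cons _ p) = suc (walkLength p)

  colours : ∀ {r u v} → Colouring G r → Walk G u v → List (Fin r)
  colours χ nil                          = []
  colours χ (cons {u = u} {w = w} e p) = Colouring.colour χ u w e ∷ colours χ p

  IsPath : ∀ {u v} → Walk G u v → Set
  IsPath p = Unique (vertices p)

  IsSuperPath : ∀ {u v} → Walk G u v → Set
  IsSuperPath p = IsPath p × walkLength p ≥ 2

  Monochromatic : ∀ {r u v} → Colouring G r → Walk G u v → Set
  Monochromatic χ p = AllPairs _≡_ (colours χ p)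

  InternallyDisjoint : ∀ {u v u′ v′} → Walk G u v → Walk G u′ v′ → Set
  InternallyDisjoint p q = Disjoint (interior p) (interior q)

-- There are k pairwise disjoint monochromatic super-paths connecting u and v;
-- different paths may have different colours.
HasDisjointMonoSuperPaths : ∀ {n r} (G : Graph n) → Colouring G r → ℕ → Fin n → Fin n → Set
HasDisjointMonoSuperPaths G χ k u v =
  Σ (Fin k → Walk G u v) λ P →
    (∀ i → IsSuperPath (P i) × Monochromatic χ (P i)) ×
    (∀ i j → i ≢ j → InternallyDisjoint (P i) (P j))

n∸2-nonZero : ∀ {n} → n ≥ 3 → NonZero (n ∸ 2)
n∸2-nonZero (s≤s (s≤s (s≤s _))) = _

{-# OPTIONS --safe #-}
module Submission where

-- Consider triples (u , x , v) where ux is an edge and v ∉ {u , x}: there are 2 e(G) (n - 2) of them,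
-- and the triple is used when a chosen path between u and v has ux as its edge at u.  Every path uses two
-- triples, so it suffices that, for all colours but one, at least 2 (n - 2) triples are lost.
-- Let S be a component of colour c with at least one edge, and put s = |S|.
--  * If s < n, the triples with ux inside S and v ∉ S are unused; as S spans at least s - 1 edges, there are
--    at least 2 (s - 1) (n - s) ≥ 2 (n - 2) of them.
--  * If s = n, and c₀ ≠ c is another colour whose component is everything, choose for each x a
--    c₀-neighbour v of x.  For an edge ux of colour c, the triples (u , x , v) and (v , x , u) are not both
--    used, since two paths of different colours would meet in x.  This loses at least 2 (n - 1) triples.
-- The chosen paths from u to v and those from v to u need not be the same, so all ordered pairs are counted:
-- each triple has capacity 2, and the number of uses is 4 w(f).

open import Defs

module Counting where

  open import Algebra.Properties.Semiring.Sum using ()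
  open import Data.Bool using (Bool; true; false; T; _∨_; if_then_else_)
  open import Data.Bool.Properties using (T?; T-∨; T-irrelevant)
  open import Data.Empty using (⊥; ⊥-elim)
  open import Data.Fin using (Fin; zero; suc; _≟_; _<?_)
  open import Data.Fin.Properties using (any?; all?; ¬∀⟶∃¬; <-cmp; suc-injective)
  open import Data.List as List using (List; []; _∷_; allFin; cartesianProduct; filter; length)
  open import Data.List.Membership.Propositional using (_∈_)
  open import Data.List.Properties using (map-tabulate; map-++; map-∘)
  open import Data.List.Relation.Unary.All as All using (All; []; _∷_)
  open import Data.List.Relation.Unary.AllPairs using (_∷_)
  open import Data.List.Relation.Unary.Any using (here; there)
  open import Data.Nat using (ℕ; zero; suc; _+_; _*_; _∸_; _≤_; z≤n; s≤s)
  open import Data.Nat.ListAction using () renaming (sum to sumL)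
  open import Data.Nat.ListAction.Properties using (sum-++)
  open import Data.Nat.Properties hiding (_≟_; _<?_; <-cmp; suc-injective)
  open import Data.Nat.Tactic.RingSolver using (solve-∀)
  open import Data.Product using (Σ; ∃; _×_; _,_; proj₁; proj₂; uncurry)
  open import Data.Sum using (_⊎_; inj₁; inj₂)
  open import Function using (_∘_; id; Equivalence)
  open import Relation.Binary using (tri<; tri≈; tri>)
  open import Relation.Binary.PropositionalEquality
  open import Relation.Nullary using (¬_; Dec; yes; no; does; ¬?; _×-dec_; _⊎-dec_; contradiction)
  open import Relation.Nullary.Decidable using (⌊_⌋; toWitness; fromWitness)
  open import Relation.Unary using (Decidable)
  open Algebra.Properties.Semiring.Sum +-*-semiring using (sum; sum-cong-≗; ∑-distrib-+; ∑-comm; *-distribˡ-sum; *-distribʳ-sum)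

  private variable
    n : ℕ
    P Q R : Set

  -- Indicators of decidable propositions and sums over `Fin n`.

  𝟙 : Dec P → ℕ
  𝟙 P? = if does P? then 1 else 0

  𝟙-yes : (P? : Dec P) → P → 𝟙 P? ≡ 1
  𝟙-yes (yes _) _ = refl
  𝟙-yes (no ¬p) p = contradiction p ¬p

  𝟙-no : (P? : Dec P) → ¬ P → 𝟙 P? ≡ 0
  𝟙-no (yes p) ¬p = contradiction p ¬p
  𝟙-no (no _)  _  = refl

  𝟙≤1 : (P? : Dec P) → 𝟙 P? ≤ 1
  𝟙≤1 (yes _) = ≤-refl
  𝟙≤1 (no _)  = z≤n

  𝟙-mono : (P? : Dec P) (Q? : Dec Q) → (P → Q) → 𝟙 P? ≤ 𝟙 Q?
  𝟙-mono (yes p) Q? P⇒Q = ≤-reflexive (sym (𝟙-yes Q? (P⇒Q p)))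
  𝟙-mono (no _)  _  _   = z≤n

  𝟙-× : (P? : Dec P) (Q? : Dec Q) → 𝟙 (P? ×-dec Q?) ≡ 𝟙 P? * 𝟙 Q?
  𝟙-× (yes _) Q? = sym (+-identityʳ (𝟙 Q?))
  𝟙-× (no _)  _  = refl

  𝟙-disjoint : (P? : Dec P) (Q? : Dec Q) (R? : Dec R) →
               (P → R) → (Q → R) → (P → ¬ Q) → 𝟙 P? + 𝟙 Q? ≤ 𝟙 R?
  𝟙-disjoint (yes p) Q? R? P⇒R _ P⇒¬Q
    rewrite 𝟙-no Q? (P⇒¬Q p) | 𝟙-yes R? (P⇒R p) = ≤-refl
  𝟙-disjoint (no _) Q? R? _ Q⇒R _ = 𝟙-mono Q? R? Q⇒R

  sum-mono-≤ : {f g : Fin n → ℕ} → (∀ i → f i ≤ g i) → sum f ≤ sum g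
  sum-mono-≤ {zero}  f≤g = z≤n
  sum-mono-≤ {suc n} f≤g = +-mono-≤ (f≤g zero) (sum-mono-≤ (f≤g ∘ suc))

  sum-const : ∀ n c → sum {n} (λ _ → c) ≡ n * c
  sum-const zero    c = refl
  sum-const (suc n) c = cong (c +_) (sum-const n c)

  sum-zero : {f : Fin n → ℕ} → (∀ i → f i ≡ 0) → sum f ≡ 0
  sum-zero {n} f≡0 = trans (sum-cong-≗ f≡0) (trans (sum-const n 0) (*-zeroʳ n))

  sum-at : (f : Fin n → ℕ) (i : Fin n) → (∀ j → j ≢ i → f j ≡ 0) → sum f ≡ f i
  sum-at f zero    f≡0 = trans (cong (f zero +_) (sum-zero λ j → f≡0 (suc j) λ ())) (+-identityʳ _)
  sum-at f (suc i) f≡0 = trans (cong (_+ sum (f ∘ suc)) (f≡0 zero λ ()))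
    (sum-at (f ∘ suc) i λ j j≢i → f≡0 (suc j) (j≢i ∘ suc-injective))

  term≤sum : (f : Fin n → ℕ) (i : Fin n) → f i ≤ sum f
  term≤sum f zero    = m≤m+n (f zero) _
  term≤sum f (suc i) = ≤-trans (term≤sum (f ∘ suc) i) (m≤n+m _ (f zero))

  sum-𝟙≟ : (i : Fin n) → sum (λ j → 𝟙 (j ≟ i)) ≡ 1
  sum-𝟙≟ i = trans (sum-at _ i λ j → 𝟙-no (j ≟ i)) (𝟙-yes (i ≟ i) refl)

  -- Serves to trace a nonzero count back to the one path or colour that causes it.
  sum-𝟙-unique : {P : Fin n → Set} (P? : Decidable P) → (∀ {i j} → P i → P j → i ≡ j) →
                 sum (λ i → 𝟙 (P? i)) ≡ 0 ⊎ (∃ λ i → P i × sum (λ i → 𝟙 (P? i)) ≡ 1)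
  sum-𝟙-unique P? unique with any? P?
  ... | yes (i , p) = inj₂ (i , p , trans (sum-at _ i λ j j≢i → 𝟙-no (P? j) λ q → j≢i (unique q p)) (𝟙-yes (P? i) p))
  ... | no ¬∃       = inj₁ (sum-zero λ i → 𝟙-no (P? i) λ p → ¬∃ (i , p))

  -- Double and triple sums over the vertices.

  ∑² : (Fin n → Fin n → ℕ) → ℕ
  ∑² f = sum λ u → sum (f u)

  ∑²-cong : {f g : Fin n → Fin n → ℕ} → (∀ u v → f u v ≡ g u v) → ∑² f ≡ ∑² g
  ∑²-cong f≡g = sum-cong-≗ λ u → sum-cong-≗ (f≡g u)

  ∑²-mono : {f g : Fin n → Fin n → ℕ} → (∀ u v → f u v ≤ g u v) → ∑² f ≤ ∑² g
  ∑²-mono f≤g = sum-mono-≤ λ u → sum-mono-≤ (f≤g u)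

  ∑²-distrib-+ : (f g : Fin n → Fin n → ℕ) → ∑² (λ u v → f u v + g u v) ≡ ∑² f + ∑² g
  ∑²-distrib-+ f g = trans (sum-cong-≗ λ u → ∑-distrib-+ (f u) (g u)) (∑-distrib-+ (sum ∘ f) (sum ∘ g))

  *-distribʳ-∑² : ∀ c (f : Fin n → Fin n → ℕ) → ∑² f * c ≡ ∑² (λ u v → f u v * c)
  *-distribʳ-∑² c f = trans (*-distribʳ-sum c (sum ∘ f)) (sum-cong-≗ λ u → *-distribʳ-sum c (f u))

  ∑³ : (Fin n → Fin n → Fin n → ℕ) → ℕ
  ∑³ f = sum λ u → ∑² (f u)

  ∑³-cong : {f g : Fin n → Fin n → Fin n → ℕ} → (∀ u x v → f u x v ≡ g u x v) → ∑³ f ≡ ∑³ g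
  ∑³-cong f≡g = sum-cong-≗ λ u → ∑²-cong (f≡g u)

  ∑³-mono : {f g : Fin n → Fin n → Fin n → ℕ} → (∀ u x v → f u x v ≤ g u x v) → ∑³ f ≤ ∑³ g
  ∑³-mono f≤g = sum-mono-≤ λ u → ∑²-mono (f≤g u)

  ∑³-distrib-+ : (f g : Fin n → Fin n → Fin n → ℕ) → ∑³ (λ u x v → f u x v + g u x v) ≡ ∑³ f + ∑³ g
  ∑³-distrib-+ f g = trans (sum-cong-≗ λ u → ∑²-distrib-+ (f u) (g u)) (∑-distrib-+ (∑² ∘ f) (∑² ∘ g))

  ∑³-swapʳ : (f : Fin n → Fin n → Fin n → ℕ) → ∑³ f ≡ ∑³ (λ u v x → f u x v)
  ∑³-swapʳ f = sum-cong-≗ λ u → ∑-comm (f u)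

  ∑³-flip : (f : Fin n → Fin n → Fin n → ℕ) → ∑³ f ≡ ∑³ (λ u x v → f v x u)
  ∑³-flip f = trans (∑³-swapʳ f) (trans (∑-comm (λ u v → sum λ x → f u x v)) (∑³-swapʳ λ v u x → f u x v))

  ∑-∑³-comm : ∀ {r} (f : Fin r → Fin n → Fin n → Fin n → ℕ) →
              ∑³ (λ u x v → sum λ c → f c u x v) ≡ sum (λ c → ∑³ (f c))
  ∑-∑³-comm f = trans (sum-cong-≗ λ u → trans (sum-cong-≗ λ x → ∑-comm λ v c → f c u x v)
    (∑-comm λ x c → sum (f c u x))) (∑-comm λ u c → ∑² (f c u))

  *-distribˡ-∑³ : ∀ c (f : Fin n → Fin n → Fin n → ℕ) → c * ∑³ f ≡ ∑³ (λ u x v → c * f u x v)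
  *-distribˡ-∑³ c f = trans (*-distribˡ-sum c (∑² ∘ f)) (sum-cong-≗ λ u →
    trans (*-distribˡ-sum c (sum ∘ f u)) (sum-cong-≗ λ x → *-distribˡ-sum c (f u x)))

  -- Exchanging `u` and `v` permutes the triples, so symmetrising doubles both sums. This lets an
  -- excess at one triple be paid for by its mirror image, as spanning colours will require.
  ∑³-mono-pairs : {f g : Fin n → Fin n → Fin n → ℕ} →
                  (∀ u x v → f u x v + f v x u ≤ g u x v + g v x u) → ∑³ f ≤ ∑³ g
  ∑³-mono-pairs {n = n} {f} {g} f≤g = *-cancelˡ-≤ 2 (subst₂ _≤_ (symmetrise f) (symmetrise g) (∑³-mono f≤g))
    where
    symmetrise : (h : Fin n → Fin n → Fin n → ℕ) → ∑³ (λ u x v → h u x v + h v x u) ≡ 2 * ∑³ h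
    symmetrise h = trans (∑³-distrib-+ h λ u x v → h v x u)
      (cong (∑³ h +_) (trans (sym (∑³-flip h)) (sym (+-identityʳ (∑³ h)))))

  -- Sums over lists of vertex pairs, and the handshake identity.

  sum-map-filter : {A : Set} {P : A → Set} (P? : Decidable P) (g : A → ℕ) (xs : List A) →
                   sumL (List.map g (filter P? xs)) ≡ sumL (List.map (λ x → 𝟙 (P? x) * g x) xs)
  sum-map-filter P? g []       = refl
  sum-map-filter P? g (x ∷ xs) with P? x
  ... | yes _ = cong₂ _+_ (sym (+-identityʳ (g x))) (sum-map-filter P? g xs)
  ... | no _  = sum-map-filter P? g xs

  length-filter : {A : Set} {P : A → Set} (P? : Decidable P) (xs : List A) →
                  length (filter P? xs) ≡ sumL (List.map (λ x → 𝟙 (P? x)) xs)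
  length-filter P? []       = refl
  length-filter P? (x ∷ xs) with P? x
  ... | yes _ = cong suc (length-filter P? xs)
  ... | no _  = length-filter P? xs

  sum-map-cartesianProduct : {A B : Set} (g : A × B → ℕ) (xs : List A) (ys : List B) →
    sumL (List.map g (cartesianProduct xs ys)) ≡ sumL (List.map (λ x → sumL (List.map (λ y → g (x , y)) ys)) xs)
  sum-map-cartesianProduct g []       ys = refl
  sum-map-cartesianProduct g (x ∷ xs) ys = begin
    sumL (List.map g (List.map (x ,_) ys List.++ cartesianProduct xs ys))
      ≡⟨ cong sumL (map-++ g (List.map (x ,_) ys) _) ⟩
    sumL (List.map g (List.map (x ,_) ys) List.++ List.map g (cartesianProduct xs ys))
      ≡⟨ sum-++ (List.map g (List.map (x ,_) ys)) _ ⟩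
    sumL (List.map g (List.map (x ,_) ys)) + sumL (List.map g (cartesianProduct xs ys))
      ≡⟨ cong₂ _+_ (cong sumL (sym (map-∘ ys))) (sum-map-cartesianProduct g xs ys) ⟩
    _ ∎
    where open ≡-Reasoning

  sum-tabulate : (g : Fin n → ℕ) → sumL (List.tabulate g) ≡ sum g
  sum-tabulate {zero}  g = refl
  sum-tabulate {suc n} g = cong (g zero +_) (sum-tabulate (g ∘ suc))

  sum-map-allFin : (g : Fin n → ℕ) → sumL (List.map g (allFin n)) ≡ sum g
  sum-map-allFin g = trans (cong sumL (map-tabulate id g)) (sum-tabulate g)

  sum-map-pairs : (g : Fin n → Fin n → ℕ) →
                  sumL (List.map (uncurry g) (pairs n)) ≡ ∑² (λ u v → 𝟙 (u <? v) * g u v)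
  sum-map-pairs {n} g = begin
    sumL (List.map (uncurry g) (pairs n))
      ≡⟨ sum-map-filter (uncurry _<?_) (uncurry g) (cartesianProduct (allFin n) (allFin n)) ⟩
    sumL (List.map g′ (cartesianProduct (allFin n) (allFin n)))
      ≡⟨ sum-map-cartesianProduct g′ (allFin n) (allFin n) ⟩
    sumL (List.map (λ u → sumL (List.map (λ v → g′ (u , v)) (allFin n))) (allFin n))
      ≡⟨ sum-map-allFin (λ u → sumL (List.map (λ v → g′ (u , v)) (allFin n))) ⟩
    sum (λ u → sumL (List.map (λ v → g′ (u , v)) (allFin n)))
      ≡⟨ sum-cong-≗ (λ u → sum-map-allFin (λ v → g′ (u , v))) ⟩
    ∑² (λ u v → 𝟙 (u <? v) * g u v) ∎
    where
    open ≡-Reasoning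
    g′ : Fin n × Fin n → ℕ
    g′ p = 𝟙 (uncurry _<?_ p) * uncurry g p

  𝟙<+𝟙> : (u v : Fin n) → 𝟙 (u <? v) + 𝟙 (v <? u) ≡ 𝟙 (¬? (u ≟ v))
  𝟙<+𝟙> u v with <-cmp u v
  ... | tri< u<v u≢v v≮u = trans (cong₂ _+_ (𝟙-yes (u <? v) u<v) (𝟙-no (v <? u) v≮u)) (sym (𝟙-yes (¬? (u ≟ v)) u≢v))
  ... | tri≈ u≮v u≡v v≮u = trans (cong₂ _+_ (𝟙-no (u <? v) u≮v) (𝟙-no (v <? u) v≮u)) (sym (𝟙-no (¬? (u ≟ v)) (contradiction u≡v)))
  ... | tri> u≮v u≢v v<u = trans (cong₂ _+_ (𝟙-no (u <? v) u≮v) (𝟙-yes (v <? u) v<u)) (sym (𝟙-yes (¬? (u ≟ v)) u≢v))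

  -- Distinct vertices satisfy exactly one of `u < v` and `v < u`, and the symmetry of `g` makes the
  -- two halves equal.
  handshake : (g : Fin n → Fin n → ℕ) → (∀ u v → g u v ≡ g v u) →
              ∑² (λ u v → 𝟙 (¬? (u ≟ v)) * g u v) ≡ 2 * sumL (List.map (uncurry g) (pairs n))
  handshake {n} g g-sym = begin
    ∑² (λ u v → 𝟙 (¬? (u ≟ v)) * g u v)
      ≡⟨ ∑²-cong (λ u v → trans (cong (_* g u v) (sym (𝟙<+𝟙> u v))) (*-distribʳ-+ (g u v) (𝟙 (u <? v)) (𝟙 (v <? u)))) ⟩
    ∑² (λ u v → 𝟙 (u <? v) * g u v + 𝟙 (v <? u) * g u v)
      ≡⟨ ∑²-distrib-+ (λ u v → 𝟙 (u <? v) * g u v) (λ u v → 𝟙 (v <? u) * g u v) ⟩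
    W + ∑² (λ u v → 𝟙 (v <? u) * g u v)
      ≡⟨ cong (W +_) (∑²-cong λ u v → cong (𝟙 (v <? u) *_) (g-sym u v)) ⟩
    W + ∑² (λ u v → 𝟙 (v <? u) * g v u)
      ≡⟨ cong (W +_) (∑-comm λ u v → 𝟙 (v <? u) * g v u) ⟩
    W + W
      ≡⟨ cong (W +_) (+-identityʳ W) ⟨
    2 * W
      ≡⟨ cong (2 *_) (sum-map-pairs g) ⟨
    2 * sumL (List.map (uncurry g) (pairs n)) ∎
    where
    open ≡-Reasoning
    W = ∑² (λ u v → 𝟙 (u <? v) * g u v)

  ∑²-adj : (G : Graph n) → ∑² (λ u v → 𝟙 (T? (Graph.adj G u v))) ≡ 2 * edgeCount G
  ∑²-adj {n} G = begin
    ∑² E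
      ≡⟨ ∑²-cong offDiagonal ⟨
    ∑² (λ u v → 𝟙 (¬? (u ≟ v)) * E u v)
      ≡⟨ handshake E (λ u v → cong (λ b → 𝟙 (T? b)) (adj-sym u v)) ⟩
    2 * sumL (List.map (uncurry E) (pairs n))
      ≡⟨ cong (2 *_) (length-filter (λ p → T? (uncurry adj p)) (pairs n)) ⟨
    2 * edgeCount G ∎
    where
    open ≡-Reasoning
    open Graph G
    E : Fin n → Fin n → ℕ
    E u v = 𝟙 (T? (adj u v))
    offDiagonal : ∀ u v → 𝟙 (¬? (u ≟ v)) * E u v ≡ E u v
    offDiagonal u v with u ≟ v
    ... | yes refl = sym (𝟙-no (T? (adj u u)) (irrefl u))
    ... | no _     = +-identityʳ (E u v)

  -- Vertex sets, their sizes and closure under a relation.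

  size : (Fin n → Bool) → ℕ
  size S = sum λ v → 𝟙 (T? (S v))

  size≤ : (S : Fin n → Bool) → size S ≤ n
  size≤ {n} S = ≤-trans (sum-mono-≤ λ v → 𝟙≤1 (T? (S v))) (≤-reflexive (trans (sum-const n 1) (*-identityʳ n)))

  Closed : (Fin n → Fin n → Set) → (Fin n → Bool) → Set
  Closed _~_ S = ∀ {x y} → x ~ y → T (S x) → T (S y)

  insert : Fin n → (Fin n → Bool) → Fin n → Bool
  insert x S v = S v ∨ ⌊ v ≟ x ⌋

  ∈-insertʳ : {x v : Fin n} (S : Fin n → Bool) → T (S v) → T (insert x S v)
  ∈-insertʳ S v∈S = Equivalence.from T-∨ (inj₁ v∈S)

  ∈-insert : (x : Fin n) (S : Fin n → Bool) → T (insert x S x)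
  ∈-insert x S = Equivalence.from T-∨ (inj₂ (fromWitness {a? = x ≟ x} refl))

  ∈-insert⁻ : {x v : Fin n} (S : Fin n → Bool) → T (insert x S v) → T (S v) ⊎ v ≡ x
  ∈-insert⁻ {x = x} {v} S v∈ with Equivalence.to (T-∨ {S v}) v∈
  ... | inj₁ v∈S = inj₁ v∈S
  ... | inj₂ v≡x = inj₂ (toWitness {a? = v ≟ x} v≡x)

  size-insert : (x : Fin n) (S : Fin n → Bool) → ¬ T (S x) → size S + 1 ≤ size (insert x S)
  size-insert x S x∉S = begin
    size S + 1
      ≡⟨ cong (size S +_) (sum-𝟙≟ x) ⟨
    size S + sum (λ v → 𝟙 (v ≟ x))
      ≡⟨ ∑-distrib-+ (λ v → 𝟙 (T? (S v))) (λ v → 𝟙 (v ≟ x)) ⟨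
    sum (λ v → 𝟙 (T? (S v)) + 𝟙 (v ≟ x))
      ≤⟨ sum-mono-≤ (λ v → 𝟙-disjoint (T? (S v)) (v ≟ x) (T? (insert x S v)) (∈-insertʳ S)
           (λ { refl → ∈-insert x S }) (λ { v∈S refl → x∉S v∈S })) ⟩
    size (insert x S) ∎
    where open ≤-Reasoning

  size-insert-≤ : (x : Fin n) (S : Fin n → Bool) → size (insert x S) ≤ size S + 1
  size-insert-≤ x S = begin
    size (insert x S)
      ≤⟨ sum-mono-≤ (λ v → pointwise v) ⟩
    sum (λ v → 𝟙 (T? (S v)) + 𝟙 (v ≟ x))
      ≡⟨ ∑-distrib-+ (λ v → 𝟙 (T? (S v))) (λ v → 𝟙 (v ≟ x)) ⟩
    size S + sum (λ v → 𝟙 (v ≟ x))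
      ≡⟨ cong (size S +_) (sum-𝟙≟ x) ⟩
    size S + 1 ∎
    where
    open ≤-Reasoning
    pointwise : ∀ v → 𝟙 (T? (insert x S v)) ≤ 𝟙 (T? (S v)) + 𝟙 (v ≟ x)
    pointwise v with S v | v ≟ x
    ... | true  | _     = s≤s z≤n
    ... | false | yes _ = ≤-refl
    ... | false | no _  = ≤-refl

  co-size : (S : Fin n → Bool) → ℕ
  co-size S = sum λ v → 𝟙 (¬? (T? (S v)))

  size+co-size : (S : Fin n → Bool) → size S + co-size S ≡ n
  size+co-size {n} S = begin
    size S + co-size S
      ≡⟨ ∑-distrib-+ (λ v → 𝟙 (T? (S v))) (λ v → 𝟙 (¬? (T? (S v)))) ⟨
    sum (λ v → 𝟙 (T? (S v)) + 𝟙 (¬? (T? (S v))))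
      ≡⟨ sum-cong-≗ (λ v → excluded (T? (S v))) ⟩
    sum {n} (λ _ → 1)
      ≡⟨ trans (sum-const n 1) (*-identityʳ n) ⟩
    n ∎
    where
    open ≡-Reasoning
    excluded : {P : Set} (P? : Dec P) → 𝟙 P? + 𝟙 (¬? P?) ≡ 1
    excluded (yes _) = refl
    excluded (no _)  = refl

  -- Applied with `s` vertices inside a component, `t` outside and `X` arcs inside. For `i = s - 2`
  -- and `j = t - 1`, the product `(s - 1) t` equals `(m - 2) + i j`, while the last hypothesis says
  -- that `X` is at least `2 (s - 1)`.
  tree-bound : ∀ {s t X m} → 2 ≤ s → 1 ≤ t → s + t ≡ m → 2 * s ≤ 2 + X → 2 * (m ∸ 2) ≤ X * t
  tree-bound {suc (suc i)} {suc j} {X} (s≤s (s≤s _)) (s≤s _) refl 2s≤ = begin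
    2 * (i + suc j)                     ≤⟨ m≤m+n _ (2 * (i * j)) ⟩
    2 * (i + suc j) + 2 * (i * j)       ≡⟨ factor i j ⟩
    2 * suc i * suc j                   ≤⟨ *-monoˡ-≤ (suc j) (+-cancelˡ-≤ 2 _ _ (≤-trans (≤-reflexive (shift i)) 2s≤)) ⟩
    X * suc j ∎
    where
    open ≤-Reasoning
    factor : ∀ i j → 2 * (i + suc j) + 2 * (i * j) ≡ 2 * suc i * suc j
    factor = solve-∀
    shift : ∀ i → 2 + 2 * suc i ≡ 2 * suc (suc i)
    shift = solve-∀

  -- Growing a component while keeping the edge bound of a tree.

  module Component {n : ℕ} {_~_ : Fin n → Fin n → Set} (_~?_ : ∀ u v → Dec (u ~ v))
                   (~-sym : ∀ {u v} → u ~ v → v ~ u) where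

    inner? : (S : Fin n → Bool) (u v : Fin n) → Dec (T (S u) × T (S v) × u ~ v)
    inner? S u v = T? (S u) ×-dec T? (S v) ×-dec (u ~? v)

    -- Ordered pairs are counted, so an edge between distinct vertices of the set contributes 2.
    arcs : (Fin n → Bool) → ℕ
    arcs S = ∑² λ u v → 𝟙 (inner? S u v)

    -- Invariants of a partly explored component. `treelike` says that `s` vertices span at least
    -- `2 (s - 1)` arcs, written without subtraction. The vertex given by `neighbour` may lie
    -- outside `S`, so that the initial singleton already qualifies.
    record Grown (a : Fin n) (S : Fin n → Bool) : Set where
      field
        root      : T (S a)
        neighbour : ∀ v → T (S v) → ∃ λ w → v ~ w
        treelike  : 2 * size S ≤ 2 + arcs S

    start : ∀ {a b} → a ~ b → Grown a (insert a λ _ → false)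
    start {a} {b} a~b = record
      { root      = ∈-insert a _
      ; neighbour = λ v v∈ → case-singleton v (∈-insert⁻ (λ _ → false) v∈)
      ; treelike  = ≤-trans (*-monoʳ-≤ 2 (≤-trans (size-insert-≤ a λ _ → false)
                      (≤-reflexive (cong (_+ 1) (sum-zero {n = n} λ _ → refl))))) (m≤m+n 2 _)
      }
      where
      case-singleton : ∀ v → T false ⊎ v ≡ a → ∃ λ w → v ~ w
      case-singleton v (inj₂ refl) = b , a~b

    -- The two directions of the edge `u x` are new: neither lies inside `S`, because `x` does not,
    -- and they differ, because `u` is in `S`. Further edges from `x` into `S` only help.
    arcs-insert : ∀ {u x} (S : Fin n → Bool) → T (S u) → ¬ T (S x) → u ~ x →
                  arcs S + 2 ≤ arcs (insert x S)
    arcs-insert {u} {x} S u∈S x∉S u~x = begin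
      arcs S + 2
        ≤⟨ +-monoʳ-≤ (arcs S) (+-mono-≤ (one≤ u x) (one≤ x u)) ⟩
      arcs S + (∑² (λ y z → 𝟙 (at? u x y z)) + ∑² (λ y z → 𝟙 (at? x u y z)))
        ≡⟨ cong (arcs S +_) (∑²-distrib-+ (λ y z → 𝟙 (at? u x y z)) (λ y z → 𝟙 (at? x u y z))) ⟨
      arcs S + ∑² (λ y z → 𝟙 (at? u x y z) + 𝟙 (at? x u y z))
        ≤⟨ +-monoʳ-≤ (arcs S) (∑²-mono λ y z → 𝟙-disjoint (at? u x y z) (at? x u y z) (new? y z)
             inj₁ inj₂ λ { (refl , refl) (refl , _) → x∉S u∈S }) ⟩
      arcs S + ∑² (λ y z → 𝟙 (new? y z))
        ≡⟨ ∑²-distrib-+ (λ y z → 𝟙 (inner? S y z)) (λ y z → 𝟙 (new? y z)) ⟨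
      ∑² (λ y z → 𝟙 (inner? S y z) + 𝟙 (new? y z))
        ≤⟨ ∑²-mono (λ y z → 𝟙-disjoint (inner? S y z) (new? y z) (inner? (insert x S) y z)
             (λ (y∈S , z∈S , y~z) → ∈-insertʳ S y∈S , ∈-insertʳ S z∈S , y~z)
             (λ { (inj₁ (refl , refl)) → ∈-insertʳ S u∈S , ∈-insert x S , u~x
                ; (inj₂ (refl , refl)) → ∈-insert x S , ∈-insertʳ S u∈S , ~-sym u~x })
             (λ { (_ , z∈S , _) (inj₁ (_ , refl)) → x∉S z∈S
                ; (y∈S , _) (inj₂ (refl , _)) → x∉S y∈S })) ⟩
      arcs (insert x S) ∎
      where
      open ≤-Reasoning
      at? : ∀ i j y z → Dec (y ≡ i × z ≡ j)
      at? i j y z = (y ≟ i) ×-dec (z ≟ j)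
      new? : ∀ y z → Dec ((y ≡ u × z ≡ x) ⊎ (y ≡ x × z ≡ u))
      new? y z = at? u x y z ⊎-dec at? x u y z
      one≤ : ∀ i j → 1 ≤ ∑² (λ y z → 𝟙 (at? i j y z))
      one≤ i j = ≤-trans (≤-reflexive (sym (𝟙-yes (at? i j i j) (refl , refl))))
        (≤-trans (term≤sum (λ z → 𝟙 (at? i j i z)) j) (term≤sum (λ y → sum λ z → 𝟙 (at? i j y z)) i))

    step : ∀ {a u x S} → Grown a S → T (S u) → ¬ T (S x) → u ~ x → Grown a (insert x S)
    step {a} {u} {x} {S} g u∈S x∉S u~x = record
      { root      = ∈-insertʳ S root
      ; neighbour = λ v v∈ → case v (∈-insert⁻ S v∈)
      ; treelike  = begin
          2 * size (insert x S) ≤⟨ *-monoʳ-≤ 2 (size-insert-≤ x S) ⟩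
          2 * (size S + 1)      ≡⟨ *-distribˡ-+ 2 (size S) 1 ⟩
          2 * size S + 2        ≤⟨ +-monoˡ-≤ 2 treelike ⟩
          2 + arcs S + 2        ≡⟨ +-assoc 2 (arcs S) 2 ⟩
          2 + (arcs S + 2)      ≤⟨ +-monoʳ-≤ 2 (arcs-insert S u∈S x∉S u~x) ⟩
          2 + arcs (insert x S) ∎
      }
      where
      open ≤-Reasoning
      open Grown g
      case : ∀ v → T (S v) ⊎ v ≡ x → ∃ λ w → v ~ w
      case v (inj₁ v∈S)  = neighbour v v∈S
      case v (inj₂ refl) = u , ~-sym u~x

    -- An edge leaving `S` adds its outer end; once no edge leaves, `S` is closed. Every insertion
    -- enlarges `S`, so `fuel` can bound the number of vertices still missing.
    grow : ∀ {a} fuel S → n ≤ size S + fuel → Grown a S → ∃ λ S′ → Grown a S′ × Closed _~_ S′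
    grow fuel S n≤ g with any? (λ u → any? (λ x → T? (S u) ×-dec ¬? (T? (S x)) ×-dec (u ~? x)))
    grow fuel S n≤ g | no ∄ = S , g , closed
      where
      closed : Closed _~_ S
      closed {u} {x} u~x u∈S with T? (S x)
      ... | yes x∈S = x∈S
      ... | no x∉S  = contradiction (u , x , u∈S , x∉S , u~x) ∄
    -- Without fuel `S` already has `n` elements, and inserting `x` would exceed `n`.
    grow zero S n≤ g | yes (u , x , u∈S , x∉S , u~x) = ⊥-elim (1+n≰n (begin
      1 + n             ≡⟨ +-comm 1 n ⟩
      n + 1             ≤⟨ +-monoˡ-≤ 1 n≤ ⟩
      size S + 0 + 1    ≡⟨ cong (_+ 1) (+-identityʳ (size S)) ⟩
      size S + 1        ≤⟨ size-insert x S x∉S ⟩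
      size (insert x S) ≤⟨ size≤ (insert x S) ⟩
      n ∎))
      where open ≤-Reasoning
    grow (suc fuel) S n≤ g | yes (u , x , u∈S , x∉S , u~x) =
      grow fuel (insert x S) (begin
        n                        ≤⟨ n≤ ⟩
        size S + suc fuel        ≡⟨ +-assoc (size S) 1 fuel ⟨
        size S + 1 + fuel        ≤⟨ +-monoˡ-≤ fuel (size-insert x S x∉S) ⟩
        size (insert x S) + fuel ∎) (step g u∈S x∉S u~x)
      where open ≤-Reasoning

    component : ∀ {a b} → a ~ b → ∃ λ S → Grown a S × Closed _~_ S
    component a~b = grow n _ (m≤n+m n _) (start a~b)

  -- Monochromatic walks in a coloured graph.

  module PathSystems {n r : ℕ} (G : Graph n) (χ : Colouring G r) where
    open Graph G
    open Colouring χ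

    Coloured : Fin r → Fin n → Fin n → Set
    Coloured c u v = Σ (T (adj u v)) λ e → colour u v e ≡ c

    coloured? : ∀ c u v → Dec (Coloured c u v)
    coloured? c u v with T? (adj u v)
    ... | no ¬e = no (¬e ∘ proj₁)
    ... | yes e with colour u v e ≟ c
    ...   | yes eq = yes (e , eq)
    ...   | no neq = no λ (e′ , eq) → neq (trans (cong (colour u v) (T-irrelevant e e′)) eq)

    coloured-sym : ∀ {c u v} → Coloured c u v → Coloured c v u
    coloured-sym {c} {u} {v} (e , eq) = e′ , trans (colour-sym v u e′ e) eq
      where e′ = subst T (adj-sym u v) e

    coloured-unique : ∀ {c d u v} → Coloured c u v → Coloured d u v → c ≡ d
    coloured-unique {u = u} {v} (e , eq) (e′ , eq′) = trans (sym eq) (trans (cong (colour u v) (T-irrelevant e e′)) eq′)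

    adj⇒≢ : ∀ {u v} → T (adj u v) → u ≢ v
    adj⇒≢ {u} e refl = irrefl u e

    -- Both functions are only meaningful on walks of length at least two.
    second penultimate : ∀ {u v} → Walk G u v → Fin n
    second {u} nil              = u
    second (cons {w = w} _ _)   = w
    penultimate {u} nil                  = u
    penultimate {u} (cons _ nil)         = u
    penultimate (cons _ p@(cons _ _))    = penultimate p

    end∈vertices : ∀ {u v} (p : Walk G u v) → v ∈ vertices p
    end∈vertices nil        = here refl
    end∈vertices (cons _ p) = there (end∈vertices p)

    interior⊆vertices : ∀ {u w v y} (e : T (adj u w)) (p : Walk G w v) → y ∈ interior (cons e p) → y ∈ vertices p
    interior⊆vertices e (cons _ p)           (here y≡w) = here y≡w
    interior⊆vertices e (cons e′ p@(cons _ _)) (there y∈) = there (interior⊆vertices e′ p y∈)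

    penultimate∈interior : ∀ {u w w′ v} (e : T (adj u w)) (e′ : T (adj w w′)) (p : Walk G w′ v) →
                           penultimate (cons e (cons e′ p)) ∈ interior (cons e (cons e′ p))
    penultimate∈interior e e′ nil            = here refl
    penultimate∈interior e e′ p@(cons e″ p′) = there (penultimate∈interior e′ e″ p′)

    penultimate-coloured : ∀ {c u w v} (e : T (adj u w)) (p : Walk G w v) → All (c ≡_) (colours χ (cons e p)) →
                           Coloured c v (penultimate (cons e p))
    penultimate-coloured e nil         (eq ∷ _)  = coloured-sym (e , sym eq)
    penultimate-coloured e (cons e′ p) (_ ∷ eqs) = penultimate-coloured e′ p eqs

    -- Each edge of colour `c` has both ends in a closed set or neither. Both directions are kept,
    -- because a triple can be used at the start or at the end of a walk.
    closed-along : ∀ {c u v S} → Closed (Coloured c) S → (p : Walk G u v) → All (c ≡_) (colours χ p) →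
                   (T (S u) → T (S v)) × (T (S v) → T (S u))
    closed-along cl nil        _          = id , id
    closed-along cl (cons e p) (eq ∷ eqs) =
      let forth , back = closed-along cl p eqs
          u~w = e , sym eq
      in forth ∘ cl u~w , cl (coloured-sym u~w) ∘ back

    -- All that the counting keeps of a single path besides its interior: the end edges with their
    -- common colour, and through `closed-ends` that a closed set contains both ends or neither.
    record MonoSuperPath {u v} (p : Walk G u v) : Set where
      field
        {c}         : Fin r
        first       : Coloured c u (second p)
        last        : Coloured c v (penultimate p)
        first∈      : second p ∈ interior p
        last∈       : penultimate p ∈ interior p
        ends≢       : u ≢ v
        first≢      : second p ≢ v
        last≢       : penultimate p ≢ u
        closed-ends : ∀ {S} → Closed (Coloured c) S → (T (S u) → T (S v)) × (T (S v) → T (S u))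

    monoSuperPath : ∀ {u v} (p : Walk G u v) → IsSuperPath p → Monochromatic χ p → MonoSuperPath p
    monoSuperPath nil          (_ , ()) _
    monoSuperPath (cons _ nil) (_ , s≤s ()) _
    monoSuperPath {u} {v} p@(cons {w = w} e q@(cons e′ q′)) (u∉ ∷ w∉ ∷ _ , _) (eqs ∷ _) = record
      -- The colour is that of the first edge, with which the head of the `AllPairs` compares all
      -- later edges.
      { first       = e , refl
      ; last        = penultimate-coloured e q (refl ∷ eqs)
      ; first∈      = here refl
      ; last∈       = penultimate∈interior e e′ q′
      ; ends≢       = All.lookup u∉ (end∈vertices q)
      ; first≢      = All.lookup w∉ (end∈vertices q′)
      ; last≢       = λ eq → All.lookup u∉ (interior⊆vertices e q (penultimate∈interior e e′ q′)) (sym eq)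
      ; closed-ends = λ cl → closed-along cl p (refl ∷ eqs)
      }

    -- Incidence slots and their number.

    -- An incidence slot: the edge ux, viewed from u, as a possible end of a super-path between u and v.
    Slot : Fin n → Fin n → Fin n → Set
    Slot u x v = T (adj u x) × v ≢ u × v ≢ x

    slot? : ∀ u x v → Dec (Slot u x v)
    slot? u x v = T? (adj u x) ×-dec ¬? (v ≟ u) ×-dec ¬? (v ≟ x)

    slot : Fin n → Fin n → Fin n → ℕ
    slot u x v = 𝟙 (slot? u x v)

    -- Each of the `2 * edgeCount G` arcs `(u , x)` admits every vertex `v` except its two distinct
    -- ends.
    ∑³-slot : ∑³ slot ≡ 2 * edgeCount G * (n ∸ 2)
    ∑³-slot = begin
      ∑³ slot
        ≡⟨ ∑²-cong row ⟩
      ∑² (λ u x → 𝟙 (T? (adj u x)) * (n ∸ 2))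
        ≡⟨ *-distribʳ-∑² (n ∸ 2) (λ u x → 𝟙 (T? (adj u x))) ⟨
      ∑² (λ u x → 𝟙 (T? (adj u x))) * (n ∸ 2)
        ≡⟨ cong (_* (n ∸ 2)) (∑²-adj G) ⟩
      2 * edgeCount G * (n ∸ 2) ∎
      where
      open ≡-Reasoning
      other? : ∀ u x v → Dec (v ≢ u × v ≢ x)
      other? u x v = ¬? (v ≟ u) ×-dec ¬? (v ≟ x)
      split : ∀ {u x} → u ≢ x → ∀ v → 𝟙 (other? u x v) + (𝟙 (v ≟ u) + 𝟙 (v ≟ x)) ≡ 1
      split {u} {x} u≢x v with v ≟ u | v ≟ x
      ... | yes refl | yes refl = contradiction refl u≢x
      ... | yes _    | no _     = refl
      ... | no _     | yes _    = refl
      ... | no _     | no _     = refl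
      others : ∀ {u x} → u ≢ x → sum (λ v → 𝟙 (other? u x v)) ≡ n ∸ 2
      others {u} {x} u≢x = begin
        N                      ≡⟨ m+n∸n≡m N 2 ⟨
        N + 2 ∸ 2              ≡⟨ cong (λ k → N + k ∸ 2) (cong₂ _+_ (sum-𝟙≟ u) (sum-𝟙≟ x)) ⟨
        N + (sum (λ v → 𝟙 (v ≟ u)) + sum (λ v → 𝟙 (v ≟ x))) ∸ 2
          ≡⟨ cong (λ k → N + k ∸ 2) (∑-distrib-+ (λ v → 𝟙 (v ≟ u)) (λ v → 𝟙 (v ≟ x))) ⟨
        N + sum (λ v → 𝟙 (v ≟ u) + 𝟙 (v ≟ x)) ∸ 2
          ≡⟨ cong (_∸ 2) (∑-distrib-+ (λ v → 𝟙 (other? u x v)) (λ v → 𝟙 (v ≟ u) + 𝟙 (v ≟ x))) ⟨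
        sum (λ v → 𝟙 (other? u x v) + (𝟙 (v ≟ u) + 𝟙 (v ≟ x))) ∸ 2
          ≡⟨ cong (_∸ 2) (sum-cong-≗ (split u≢x)) ⟩
        sum {n} (λ _ → 1) ∸ 2  ≡⟨ cong (_∸ 2) (trans (sum-const n 1) (*-identityʳ n)) ⟩
        n ∸ 2 ∎
        where N = sum (λ v → 𝟙 (other? u x v))
      row : ∀ u x → sum (slot u x) ≡ 𝟙 (T? (adj u x)) * (n ∸ 2)
      row u x = begin
        sum (slot u x)
          ≡⟨ sum-cong-≗ (λ v → 𝟙-× (T? (adj u x)) (other? u x v)) ⟩
        sum (λ v → 𝟙 (T? (adj u x)) * 𝟙 (other? u x v))
          ≡⟨ *-distribˡ-sum (𝟙 (T? (adj u x))) (λ v → 𝟙 (other? u x v)) ⟨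
        𝟙 (T? (adj u x)) * sum (λ v → 𝟙 (other? u x v))
          ≡⟨ edgewise (T? (adj u x)) ⟩
        𝟙 (T? (adj u x)) * (n ∸ 2) ∎
        where
        edgewise : (e? : Dec (T (adj u x))) → 𝟙 e? * sum (λ v → 𝟙 (other? u x v)) ≡ 𝟙 e? * (n ∸ 2)
        edgewise (yes e) = cong (1 *_) (others (adj⇒≢ e))
        edgewise (no _)  = refl

    -- One component for each colour.

    module _ (c : Fin r) where
      open Component (coloured? c) coloured-sym public using (arcs; module Grown; Grown; inner?)

      private
        a b : Fin n
        a = proj₁ (onto c)
        b = proj₁ (proj₂ (onto c))

        a~b : Coloured c a b
        a~b = proj₂ (proj₂ (onto c))

        -- This is where the occurrence of every colour enters: `onto` supplies the edge `a b` from
        -- which the component is grown.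
        comp : ∃ λ S → Grown a S × Closed (Coloured c) S
        comp = Component.component (coloured? c) coloured-sym a~b

      comp-set : Fin n → Bool
      comp-set = proj₁ comp

      comp-grown : Grown a comp-set
      comp-grown = proj₁ (proj₂ comp)

      comp-closed : Closed (Coloured c) comp-set
      comp-closed = proj₂ (proj₂ comp)

      Spanning : Set
      Spanning = ∀ v → T (comp-set v)

      spanning? : Dec Spanning
      spanning? = all? λ v → T? (comp-set v)

      2≤size : 2 ≤ size comp-set
      2≤size = begin
        2
          ≡⟨ cong₂ _+_ (sum-𝟙≟ a) (sum-𝟙≟ b) ⟨
        sum (λ v → 𝟙 (v ≟ a)) + sum (λ v → 𝟙 (v ≟ b))
          ≡⟨ ∑-distrib-+ (λ v → 𝟙 (v ≟ a)) (λ v → 𝟙 (v ≟ b)) ⟨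
        sum (λ v → 𝟙 (v ≟ a) + 𝟙 (v ≟ b))
          ≤⟨ sum-mono-≤ (λ v → 𝟙-disjoint (v ≟ a) (v ≟ b) (T? (comp-set v))
               (λ { refl → Grown.root comp-grown })
               (λ { refl → comp-closed a~b (Grown.root comp-grown) })
               (λ { refl a≡b → adj⇒≢ (proj₁ a~b) a≡b })) ⟩
        size comp-set ∎
        where open ≤-Reasoning

    -- Finds the colour that will be exempt from charging. If some colour spans, such a one is
    -- taken, so that every other spanning colour has it as a partner; otherwise the condition is
    -- vacuous and the argument serves as default.
    spanning-pick : Fin r → ∃ λ c₀ → ∀ c → Spanning c → Spanning c₀
    spanning-pick c with any? spanning?
    ... | yes (c₀ , sp) = c₀ , λ _ _ → sp
    ... | no ∄          = c , λ d sp → contradiction (d , sp) ∄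

    -- How often the chosen paths use each slot.

    module Usage (k : Fin n → Fin n → ℕ) (P : ∀ u v → Fin (k u v) → Walk G u v)
                 (mono : ∀ u v i → MonoSuperPath (P u v i))
                 (disjoint : ∀ u v i j → i ≢ j → InternallyDisjoint (P u v i) (P u v j)) where

      open MonoSuperPath

      -- Disjointness in the form used below: an interior vertex identifies its path.
      same-path : ∀ {u v x} {i j : Fin (k u v)} → x ∈ interior (P u v i) → x ∈ interior (P u v j) → i ≡ j
      same-path {u} {v} {x} {i} {j} x∈i x∈j with i ≟ j
      ... | yes i≡j = i≡j
      ... | no i≢j  = contradiction (x∈i , x∈j) (disjoint u v i j i≢j)

      starts ends : Fin n → Fin n → Fin n → ℕ
      starts u v x = sum λ i → 𝟙 (second (P u v i) ≟ x)
      ends   u v x = sum λ i → 𝟙 (penultimate (P u v i) ≟ x)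

      starts-view : ∀ u v x → starts u v x ≡ 0 ⊎ (∃ λ i → second (P u v i) ≡ x × starts u v x ≡ 1)
      starts-view u v x = sum-𝟙-unique (λ i → second (P u v i) ≟ x) λ {i} {j} i≡ j≡ →
        same-path (subst (_∈ _) i≡ (first∈ (mono u v i))) (subst (_∈ _) j≡ (first∈ (mono u v j)))

      ends-view : ∀ u v x → ends u v x ≡ 0 ⊎ (∃ λ i → penultimate (P u v i) ≡ x × ends u v x ≡ 1)
      ends-view u v x = sum-𝟙-unique (λ i → penultimate (P u v i) ≟ x) λ {i} {j} i≡ j≡ →
        same-path (subst (_∈ _) i≡ (last∈ (mono u v i))) (subst (_∈ _) j≡ (last∈ (mono u v j)))

      starts≤slot : ∀ u v x → starts u v x ≤ slot u x v
      starts≤slot u v x with starts-view u v x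
      ... | inj₁ eq = ≤-trans (≤-reflexive eq) z≤n
      ... | inj₂ (i , refl , eq) = ≤-reflexive (trans eq (sym (𝟙-yes (slot? u x v)
              (proj₁ (first p) , ends≢ p ∘ sym , first≢ p ∘ sym))))
        where p = mono u v i

      ends≤slot : ∀ u v x → ends v u x ≤ slot u x v
      ends≤slot u v x with ends-view v u x
      ... | inj₁ eq = ≤-trans (≤-reflexive eq) z≤n
      ... | inj₂ (i , refl , eq) = ≤-reflexive (trans eq (sym (𝟙-yes (slot? u x v)
              (proj₁ (last p) , ends≢ p , last≢ p ∘ sym))))
        where p = mono v u i

      -- Two systems compete for the slot: paths from `u` to `v` that leave along `u x`, and paths
      -- from `v` to `u` that arrive along it. Each takes it at most once, hence the capacity 2.
      used : Fin n → Fin n → Fin n → ℕ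
      used u x v = starts u v x + ends v u x

      used≤ : ∀ u x v → used u x v ≤ 2 * slot u x v
      used≤ u x v = ≤-trans (+-mono-≤ (starts≤slot u v x) (ends≤slot u v x))
        (≤-reflexive (cong (slot u x v +_) (sym (+-identityʳ (slot u x v)))))

      -- Every path has exactly one second and one penultimate vertex, so it is counted once by
      -- `starts` and once by `ends`.
      ∑³-used : ∑³ used ≡ 2 * ∑² k
      ∑³-used = begin
        ∑³ used
          ≡⟨ ∑³-distrib-+ (λ u x v → starts u v x) (λ u x v → ends v u x) ⟩
        ∑³ (λ u x v → starts u v x) + ∑³ (λ u x v → ends v u x)
          ≡⟨ cong₂ _+_ (∑³-swapʳ λ u x v → starts u v x)
               (trans (∑³-flip λ u x v → ends v u x) (∑³-swapʳ λ v x u → ends v u x)) ⟩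
        ∑³ starts + ∑³ ends
          ≡⟨ cong₂ _+_ (∑²-cong λ u v → count (λ i → second (P u v i)))
               (∑²-cong λ u v → count (λ i → penultimate (P u v i))) ⟩
        ∑² k + ∑² k
          ≡⟨ cong (∑² k +_) (+-identityʳ (∑² k)) ⟨
        2 * ∑² k ∎
        where
        open ≡-Reasoning
        count : ∀ {m} (h : Fin m → Fin n) → sum (λ x → sum λ i → 𝟙 (h i ≟ x)) ≡ m
        count {m} h = begin
          sum (λ x → sum λ i → 𝟙 (h i ≟ x)) ≡⟨ ∑-comm (λ x i → 𝟙 (h i ≟ x)) ⟩
          sum (λ i → sum λ x → 𝟙 (h i ≟ x))
            ≡⟨ sum-cong-≗ (λ i → trans (sum-at _ (h i) λ x x≢ → 𝟙-no (h i ≟ x) (x≢ ∘ sym)) (𝟙-yes (h i ≟ h i) refl)) ⟩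
          sum {m} (λ _ → 1)                 ≡⟨ trans (sum-const m 1) (*-identityʳ m) ⟩
          m ∎

      -- A path using the slot contains the edge `u x`, hence has colour `c`, and would carry
      -- membership in `S` from `u` to `v`.
      unused-across : ∀ {c u x v S} → Closed (Coloured c) S → Coloured c u x → T (S u) → ¬ T (S v) → used u x v ≡ 0
      unused-across {c} {u} {x} {v} {S} cl u~x u∈S v∉S = cong₂ _+_ starts≡0 ends≡0
        where
        starts≡0 : starts u v x ≡ 0
        starts≡0 with starts-view u v x
        ... | inj₁ eq = eq
        ... | inj₂ (i , refl , _) with coloured-unique (first (mono u v i)) u~x
        ...   | refl = contradiction (proj₁ (closed-ends (mono u v i) cl) u∈S) v∉S
        ends≡0 : ends v u x ≡ 0
        ends≡0 with ends-view v u x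
        ... | inj₁ eq = eq
        ... | inj₂ (i , refl , _) with coloured-unique (last (mono v u i)) u~x
        ...   | refl = contradiction (proj₂ (closed-ends (mono v u i) cl) u∈S) v∉S

      -- If both counts were 1, paths of different colours would share the interior vertex x.
      cherry-bound : ∀ {c d u x v} → c ≢ d → Coloured c u x → Coloured d v x → starts u v x + ends u v x ≤ 1
      cherry-bound {c} {d} {u} {x} {v} c≢d u~x v~x with starts-view u v x | ends-view u v x
      ... | inj₁ eq           | inj₁ eq′          rewrite eq | eq′ = z≤n
      ... | inj₁ eq           | inj₂ (_ , _ , eq′) rewrite eq | eq′ = ≤-refl
      ... | inj₂ (_ , _ , eq) | inj₁ eq′          rewrite eq | eq′ = ≤-refl
      ... | inj₂ (i , i≡ , _) | inj₂ (j , j≡ , _)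
        with same-path (subst (_∈ _) i≡ (first∈ (mono u v i))) (subst (_∈ _) j≡ (last∈ (mono u v j)))
      ...   | refl = contradiction
        (trans (sym (coloured-unique (subst (Coloured _ u) i≡ (first p)) u~x)) (coloured-unique (subst (Coloured _ v) j≡ (last p)) v~x)) c≢d
        where p = mono u v i

      -- The four counts are regrouped by direction: `cherry-bound` applies once to the system from
      -- `u` to `v` and once to that from `v` to `u`.
      used-cherry : ∀ {c d u x v} → c ≢ d → Coloured c u x → Coloured d v x → used u x v + used v x u ≤ 2
      used-cherry {u = u} {x} {v} c≢d u~x v~x = begin
        (starts u v x + ends v u x) + (starts v u x + ends u v x)
          ≡⟨ regroup (starts u v x) (ends v u x) (starts v u x) (ends u v x) ⟩
        (starts u v x + ends u v x) + (starts v u x + ends v u x)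
          ≤⟨ +-mono-≤ (cherry-bound c≢d u~x v~x) (cherry-bound (c≢d ∘ sym) v~x u~x) ⟩
        2 ∎
        where
        open ≤-Reasoning
        regroup : ∀ a b c d → (a + b) + (c + d) ≡ (a + d) + (c + b)
        regroup = solve-∀

      -- Charges of each colour against the slots.

      -- A charge of colour c at (u , x , v) certifies a lost use of the slots (u , x , v) and (v , x , u).
      Loss : Fin r → Fin r → Fin n → Fin n → Fin n → Set
      Loss c₀ c u x v = c ≢ c₀ × Coloured c u x × ((Slot u x v × used u x v ≡ 0) ⊎ Coloured c₀ v x)

      -- A common interface for the spanning and the non-spanning case. `many` is conditional so
      -- that the exempt colour `c₀` can have the empty charge.
      record Charging (c₀ c : Fin r) : Set₁ where
        field
          Charge  : Fin n → Fin n → Fin n → Set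
          charge? : ∀ u x v → Dec (Charge u x v)
          loss    : ∀ {u x v} → Charge u x v → Loss c₀ c u x v
          many    : c ≢ c₀ → 2 * (n ∸ 2) ≤ ∑³ (λ u x v → 𝟙 (charge? u x v))

      across-charging : ∀ c₀ c → c ≢ c₀ → ¬ Spanning c → Charging c₀ c
      across-charging c₀ c c≢c₀ ¬sp = record
        { Charge  = λ u x v → (T (S u) × T (S x) × Coloured c u x) × ¬ T (S v)
        ; charge? = charge?
        ; loss    = λ ((u∈S , x∈S , u~x) , v∉S) → c≢c₀ , u~x , inj₁
            ((proj₁ u~x , (λ { refl → v∉S u∈S }) , (λ { refl → v∉S x∈S }))
            , unused-across (comp-closed c) u~x u∈S v∉S)
        ; many    = λ _ → begin
            2 * (n ∸ 2)
              ≤⟨ tree-bound (2≤size c) 1≤co-size (size+co-size S) (Grown.treelike (comp-grown c)) ⟩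
            arcs c S * co-size S
              ≡⟨ *-distribʳ-∑² (co-size S) (λ u x → 𝟙 (inner? c S u x)) ⟩
            ∑² (λ u x → 𝟙 (inner? c S u x) * co-size S)
              ≡⟨ ∑²-cong (λ u x → *-distribˡ-sum (𝟙 (inner? c S u x)) (λ v → 𝟙 (¬? (T? (S v))))) ⟩
            ∑³ (λ u x v → 𝟙 (inner? c S u x) * 𝟙 (¬? (T? (S v))))
              ≡⟨ ∑³-cong (λ u x v → 𝟙-× (inner? c S u x) (¬? (T? (S v)))) ⟨
            ∑³ (λ u x v → 𝟙 (charge? u x v)) ∎
        }
        where
        open ≤-Reasoning
        S : Fin n → Bool
        S = comp-set c
        charge? : ∀ u x v → Dec ((T (S u) × T (S x) × Coloured c u x) × ¬ T (S v))
        charge? u x v = inner? c S u x ×-dec ¬? (T? (S v))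
        outside : ∃ λ v → ¬ T (S v)
        outside = ¬∀⟶∃¬ n _ (λ v → T? (S v)) ¬sp
        1≤co-size : 1 ≤ co-size S
        1≤co-size = ≤-trans (≤-reflexive (sym (𝟙-yes (¬? (T? (S (proj₁ outside)))) (proj₂ outside))))
          (term≤sum (λ v → 𝟙 (¬? (T? (S v)))) (proj₁ outside))

      -- Each arc `(u , x)` of colour `c` is charged exactly once, at the fixed `c₀`-neighbour
      -- `mate x`. That neighbour exists because the component of `c₀` contains `x`.
      cherry-charging : ∀ c₀ c → c ≢ c₀ → Spanning c → Spanning c₀ → Charging c₀ c
      cherry-charging c₀ c c≢c₀ sp sp₀ = record
        { Charge  = λ u x v → Coloured c u x × v ≡ mate x
        ; charge? = charge?
        ; loss    = λ { (u~x , refl) → c≢c₀ , u~x , inj₂ (coloured-sym (proj₂ (mates _))) }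
        ; many    = λ _ → begin
            2 * (n ∸ 2)
              -- The tree bound yields `2 * (n ∸ 1)`, slightly more than is asked.
              ≤⟨ *-monoʳ-≤ 2 (∸-monoʳ-≤ n (s≤s z≤n)) ⟩
            2 * (n ∸ 1)
              ≡⟨ *-distribˡ-∸ 2 n 1 ⟩
            2 * n ∸ 2
              ≤⟨ ∸-monoˡ-≤ 2 (*-monoʳ-≤ 2 n≤size) ⟩
            2 * size S ∸ 2
              ≤⟨ m≤n+o⇒m∸n≤o _ 2 (Grown.treelike (comp-grown c)) ⟩
            arcs c S
              ≤⟨ ∑²-mono (λ u x → 𝟙-mono (inner? c S u x) (coloured? c u x) (proj₂ ∘ proj₂)) ⟩
            ∑² (λ u x → 𝟙 (coloured? c u x))
              ≡⟨ ∑²-cong row ⟨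
            ∑³ (λ u x v → 𝟙 (charge? u x v)) ∎
        }
        where
        open ≤-Reasoning
        S : Fin n → Bool
        S = comp-set c
        mates : ∀ x → ∃ λ v → Coloured c₀ x v
        mates x = Grown.neighbour (comp-grown c₀) x (sp₀ x)
        mate : Fin n → Fin n
        mate = proj₁ ∘ mates
        charge? : ∀ u x v → Dec (Coloured c u x × v ≡ mate x)
        charge? u x v = coloured? c u x ×-dec (v ≟ mate x)
        n≤size : n ≤ size S
        n≤size = ≤-reflexive (trans (sym (trans (sum-const n 1) (*-identityʳ n)))
          (sum-cong-≗ λ v → sym (𝟙-yes (T? (S v)) (sp v))))
        row : ∀ u x → sum (λ v → 𝟙 (charge? u x v)) ≡ 𝟙 (coloured? c u x)
        row u x = trans (sum-at _ (mate x) λ v v≢ → 𝟙-no (charge? u x v) (v≢ ∘ proj₂))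
          (trans (𝟙-× (coloured? c u x) (mate x ≟ mate x))
          (trans (cong (𝟙 (coloured? c u x) *_) (𝟙-yes (mate x ≟ mate x) refl)) (*-identityʳ _)))

      charging : ∀ c₀ → (∀ c → Spanning c → Spanning c₀) → ∀ c → Charging c₀ c
      charging c₀ pick c with c ≟ c₀
      -- The exempt colour charges nothing, and its `many` is vacuous.
      ... | yes c≡c₀ = record
        { Charge = λ _ _ _ → ⊥ ; charge? = λ _ _ _ → no id ; loss = λ () ; many = contradiction c≡c₀ }
      ... | no c≢c₀ with spanning? c
      ...   | yes sp = cherry-charging c₀ c c≢c₀ sp (pick c sp)
      ...   | no ¬sp = across-charging c₀ c c≢c₀ ¬sp

      -- Discharging: uses and charges against the capacity of the slots.

      module Discharge (c₀ : Fin r) (pick : ∀ c → Spanning c → Spanning c₀) where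
        module Ch c = Charging (charging c₀ pick c)

        charges : Fin n → Fin n → Fin n → ℕ
        charges u x v = sum λ c → 𝟙 (Ch.charge? c u x v)

        -- A charge at `(u , x , v)` determines its colour, namely that of the edge `u x`, so
        -- charges of different colours never coincide.
        charges-view : ∀ u x v → charges u x v ≡ 0 ⊎ (∃ λ c → Loss c₀ c u x v × charges u x v ≡ 1)
        charges-view u x v with sum-𝟙-unique (λ c → Ch.charge? c u x v)
          (λ {c} {d} p q → coloured-unique (proj₁ (proj₂ (Ch.loss c p))) (proj₁ (proj₂ (Ch.loss d q))))
        ... | inj₁ eq           = inj₁ eq
        ... | inj₂ (c , p , eq) = inj₂ (c , Ch.loss c p , eq)

        -- The summand `2 * (n ∸ 2)` on the right stands in for the exempt colour, so that `r - 1`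
        -- need not be formed.
        ∑³-charges : 2 * (n ∸ 2) * r ≤ ∑³ charges + 2 * (n ∸ 2)
        ∑³-charges = begin
          m * r
            ≡⟨ trans (*-comm m r) (sym (sum-const r m)) ⟩
          sum {r} (λ _ → m)
            ≤⟨ sum-mono-≤ bound ⟩
          sum (λ c → total c + 𝟙 (c ≟ c₀) * m)
            ≡⟨ ∑-distrib-+ total (λ c → 𝟙 (c ≟ c₀) * m) ⟩
          sum total + sum (λ c → 𝟙 (c ≟ c₀) * m)
            ≡⟨ cong₂ _+_ (∑-∑³-comm (λ c u x v → 𝟙 (Ch.charge? c u x v))) (*-distribʳ-sum m (λ c → 𝟙 (c ≟ c₀))) ⟨
          ∑³ charges + sum (λ c → 𝟙 (c ≟ c₀)) * m
            ≡⟨ cong (∑³ charges +_) (trans (cong (_* m) (sum-𝟙≟ c₀)) (*-identityˡ m)) ⟩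
          ∑³ charges + m ∎
          where
          open ≤-Reasoning
          m = 2 * (n ∸ 2)
          total : Fin r → ℕ
          total c = ∑³ λ u x v → 𝟙 (Ch.charge? c u x v)
          bound : ∀ c → m ≤ total c + 𝟙 (c ≟ c₀) * m
          -- The decision is passed as an argument so that `𝟙` reduces when it is split.
          bound c = by-cases (c ≟ c₀)
            where
            by-cases : (d : Dec (c ≡ c₀)) → m ≤ total c + 𝟙 d * m
            by-cases (yes _)   = ≤-trans (≤-reflexive (sym (*-identityˡ m))) (m≤n+m (1 * m) (total c))
            by-cases (no c≢c₀) = ≤-trans (Ch.many c c≢c₀) (m≤m+n (total c) _)

        -- A charge takes up both units of the capacity of a slot, hence its factor 2.
        Balanced : Fin n → Fin n → Fin n → Set
        Balanced u x v = used u x v + 2 * charges u x v ≤ 2 * slot u x v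

        balance : ∀ u x v → Balanced u x v ⊎ (∃ λ c → c ≢ c₀ × Coloured c u x × Coloured c₀ v x × charges u x v ≡ 1)
        balance u x v with charges-view u x v
        ... | inj₁ eq = inj₁ (≤-trans (≤-reflexive (trans (cong (λ k → used u x v + 2 * k) eq) (+-identityʳ _))) (used≤ u x v))
        ... | inj₂ (c , (_ , _ , inj₁ (s , unused)) , eq) =
                inj₁ (≤-reflexive (cong₂ _+_ unused (cong (2 *_) (trans eq (sym (𝟙-yes (slot? u x v) s))))))
        ... | inj₂ (c , (c≢c₀ , u~x , inj₂ v~x) , eq) = inj₂ (c , c≢c₀ , u~x , v~x , eq)

        -- The mirror slot is uncharged: its edge `v x` has the exempt colour `c₀`. So the two
        -- slots, of total capacity 4, carry one charge worth 2 and, by `used-cherry`, at most 2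
        -- uses.
        cherry-balance : ∀ {c u x v} → c ≢ c₀ → Coloured c u x → Coloured c₀ v x → charges u x v ≡ 1 →
                         (used u x v + 2 * charges u x v) + (used v x u + 2 * charges v x u) ≤ 2 * slot u x v + 2 * slot v x u
        cherry-balance {c} {u} {x} {v} c≢c₀ u~x v~x charged = begin
          (used u x v + 2 * charges u x v) + (used v x u + 2 * charges v x u)
            ≡⟨ cong₂ (λ k l → (used u x v + 2 * k) + (used v x u + 2 * l)) charged uncharged ⟩
          (used u x v + 2) + (used v x u + 0)
            ≡⟨ regroup (used u x v) (used v x u) ⟩
          (used u x v + used v x u) + 2
            ≤⟨ +-monoˡ-≤ 2 (used-cherry c≢c₀ u~x v~x) ⟩
          4
            ≡⟨ cong₂ (λ k l → 2 * k + 2 * l) (𝟙-yes (slot? u x v) (proj₁ u~x , u≢v ∘ sym , adj⇒≢ (proj₁ v~x)))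
                 (𝟙-yes (slot? v x u) (proj₁ v~x , u≢v , adj⇒≢ (proj₁ u~x))) ⟨
          2 * slot u x v + 2 * slot v x u ∎
          where
          open ≤-Reasoning
          regroup : ∀ a b → (a + 2) + (b + 0) ≡ (a + b) + 2
          regroup = solve-∀
          u≢v : u ≢ v
          u≢v refl = c≢c₀ (coloured-unique u~x v~x)
          uncharged : charges v x u ≡ 0
          uncharged with charges-view v x u
          ... | inj₁ eq                           = eq
          ... | inj₂ (_ , (d≢c₀ , v~x′ , _) , _) = contradiction (coloured-unique v~x′ v~x) d≢c₀

        pair-balance : ∀ u x v → (used u x v + 2 * charges u x v) + (used v x u + 2 * charges v x u)
                               ≤ 2 * slot u x v + 2 * slot v x u
        pair-balance u x v with balance u x v | balance v x u
        ... | inj₁ b | inj₁ b′ = +-mono-≤ b b′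
        ... | inj₂ (_ , c≢c₀ , u~x , v~x , eq) | _ = cherry-balance c≢c₀ u~x v~x eq
        ... | inj₁ _ | inj₂ (_ , c≢c₀ , v~x , u~x , eq) =
          subst₂ _≤_ (+-comm (used v x u + 2 * charges v x u) _) (+-comm (2 * slot v x u) _) (cherry-balance c≢c₀ v~x u~x eq)

        ∑³-balance : ∑³ used + 2 * ∑³ charges ≤ 2 * ∑³ slot
        ∑³-balance = begin
          ∑³ used + 2 * ∑³ charges                     ≡⟨ cong (∑³ used +_) (*-distribˡ-∑³ 2 charges) ⟩
          ∑³ used + ∑³ (λ u x v → 2 * charges u x v)   ≡⟨ ∑³-distrib-+ used (λ u x v → 2 * charges u x v) ⟨
          ∑³ (λ u x v → used u x v + 2 * charges u x v) ≤⟨ ∑³-mono-pairs pair-balance ⟩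
          ∑³ (λ u x v → 2 * slot u x v)                ≡⟨ *-distribˡ-∑³ 2 slot ⟨
          2 * ∑³ slot ∎
          where open ≤-Reasoning

      -- Everything is compared with a factor 4: `∑² k` runs over ordered pairs, and every path has
      -- two end edges. The successor of `edgeCount G` accounts for the exempt colour.
      slot-count-bound : ∀ w → ∑² k ≡ 2 * w → w + (n ∸ 2) * r ≤ (n ∸ 2) * suc (edgeCount G)
      slot-count-bound w ∑k = by-colours r refl
        where
        open ≤-Reasoning
        d e : ℕ
        d = n ∸ 2
        e = edgeCount G

        ∑used : 4 * w ≡ ∑³ used
        ∑used = trans (*-assoc 2 2 w) (sym (trans ∑³-used (cong (2 *_) ∑k)))

        ∑slots : 2 * ∑³ slot ≡ 4 * (e * d)
        ∑slots = trans (cong (2 *_) (trans ∑³-slot (*-assoc 2 e d))) (sym (*-assoc 2 2 (e * d)))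

        by-colours : ∀ r′ → r ≡ r′ → w + d * r ≤ d * suc e
        -- Without colours there is none to exempt: capacity alone bounds `w` by `e * d`, and the
        -- extra `d` is slack.
        by-colours zero refl = *-cancelˡ-≤ 4 (begin
          4 * (w + d * 0)      ≡⟨ no-colours d w ⟩
          4 * w                ≡⟨ ∑used ⟩
          ∑³ used              ≤⟨ ∑³-mono used≤ ⟩
          ∑³ (λ u x v → 2 * slot u x v) ≡⟨ *-distribˡ-∑³ 2 slot ⟨
          2 * ∑³ slot          ≡⟨ ∑slots ⟩
          4 * (e * d)          ≤⟨ *-monoʳ-≤ 4 (m≤n+m (e * d) d) ⟩
          4 * (d + e * d)      ≡⟨ cong (4 *_) (*-comm (suc e) d) ⟩
          4 * (d * suc e) ∎)
          where
          no-colours : ∀ d w → 4 * (w + d * 0) ≡ 4 * w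
          no-colours = solve-∀
        by-colours (suc _) refl = *-cancelˡ-≤ 4 (begin
          4 * (w + d * r)                       ≡⟨ expand w d r ⟩
          4 * w + 2 * (2 * d * r)               ≤⟨ +-mono-≤ (≤-reflexive ∑used) (*-monoʳ-≤ 2 ∑³-charges) ⟩
          ∑³ used + 2 * (∑³ charges + 2 * d)    ≡⟨ regroup (∑³ used) (∑³ charges) d ⟩
          ∑³ used + 2 * ∑³ charges + 4 * d      ≤⟨ +-monoˡ-≤ (4 * d) ∑³-balance ⟩
          2 * ∑³ slot + 4 * d                   ≡⟨ cong (_+ 4 * d) ∑slots ⟩
          4 * (e * d) + 4 * d                   ≡⟨ collect e d ⟩
          4 * (d * suc e) ∎)
          where
          -- Since `r` is positive, the colour `zero` exists and can serve as the default.
          open Discharge (proj₁ (spanning-pick zero)) (proj₂ (spanning-pick zero))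
          expand : ∀ w d r → 4 * (w + d * r) ≡ 4 * w + 2 * (2 * d * r)
          expand = solve-∀
          regroup : ∀ a b d → a + 2 * (b + 2 * d) ≡ a + 2 * b + 4 * d
          regroup = solve-∀
          collect : ∀ e d → 4 * (e * d) + 4 * d ≡ 4 * (d * suc e)
          collect = solve-∀

  weight-bound : ∀ {n r} (G : Graph n) (χ : Colouring G r) (f : PairFunction n) →
                 (∀ u v → u ≢ v → HasDisjointMonoSuperPaths G χ (f ⟨ u , v ⟩) u v) →
                 weight f + (n ∸ 2) * r ≤ (n ∸ 2) * suc (edgeCount G)
  weight-bound {n} G χ f paths = slot-count-bound (weight f)
    (trans (∑²-cong λ u v → proj₁ (proj₂ (system u v))) (handshake (f ⟨_,_⟩) (PairFunction.symm f)))
    where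
    system : ∀ u v → ∃ λ k → k ≡ 𝟙 (¬? (u ≟ v)) * (f ⟨ u , v ⟩) × HasDisjointMonoSuperPaths G χ k u v
    system u v with u ≟ v
    -- The diagonal gets the empty system, matching the indicator in `handshake`.
    ... | yes _  = 0 , refl , (λ ()) , (λ ()) , λ ()
    ... | no u≢v = f ⟨ u , v ⟩ , sym (+-identityʳ _) , paths u v u≢v

    open PathSystems G χ
    open Usage (λ u v → proj₁ (system u v)) (λ u v → proj₁ (proj₂ (proj₂ (system u v))))
      (λ u v i → uncurry (monoSuperPath _) (proj₁ (proj₂ (proj₂ (proj₂ (system u v)))) i))
      (λ u v → proj₂ (proj₂ (proj₂ (proj₂ (system u v)))))

-- From the inequality of natural numbers to the ceiling.

module Ceiling where

  open import Data.Integer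
  open import Data.Integer.DivMod using (n<s[n/ℕd]*d; div-pos-is-/ℕ)
  open import Data.Integer.GCD using (gcd)
  open import Data.Integer.Properties
  open import Data.Integer.Tactic.RingSolver using (solve-∀)
  open import Data.Nat as ℕ using (ℕ)
  open import Data.Rational as ℚ using (ℚ; ↥_; ↧_; ↧ₙ_; floor; ceiling)
  open import Data.Rational.Properties using (↥-/; ↧-/; ↥-neg; ↧-neg)
  open import Relation.Binary.PropositionalEquality

  -- Division bounds the numerator strictly by `floor p + 1` times the denominator; cancelling the
  -- positive denominator leaves `z < floor p + 1`.
  ≤-floor : ∀ p z → z * ↧ p ≤ ↥ p → z ≤ floor p
  ≤-floor p@record{} z zd≤n = subst (z ≤_) (sym (div-pos-is-/ℕ (↥ p) (↧ₙ p)))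
    (<suc⇒≤ (*-cancelʳ-<-nonNeg (↧ p) (≤-<-trans zd≤n (n<s[n/ℕd]*d (↥ p) (↧ₙ p)))))
    where
    <suc⇒≤ : ∀ {i j} → i < suc j → i ≤ j
    <suc⇒≤ i<1+j = ≤-trans (i<j⇒i≤pred[j] i<1+j) (≤-reflexive (pred-suc _))

  -- `ceiling` is minus the `floor` of the negative, so `≤-floor` is applied to `- q` and `- z`.
  ceiling-≤ : ∀ q z → ↥ q ≤ z * ↧ q → ceiling q ≤ z
  ceiling-≤ q@record{} z n≤zd = subst (ceiling q ≤_) (neg-involutive z) (neg-mono-≤ (≤-floor (ℚ.- q) (- z) (begin
    - z * ↧ (ℚ.- q) ≡⟨ cong (- z *_) (↧-neg q) ⟩
    - z * ↧ q       ≡⟨ neg-distribˡ-* z (↧ q) ⟨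
    - (z * ↧ q)     ≤⟨ neg-mono-≤ n≤zd ⟩
    - ↥ q           ≡⟨ ↥-neg q ⟨
    ↥ (ℚ.- q)       ∎)))
    where open ≤-Reasoning

  -- The quotient is stored in lowest terms. Multiplying by the gcd restores `i` and `d`, and this
  -- positive factor cancels.
  ceiling-/-≤ : ∀ i d .{{_ : ℕ.NonZero d}} z → i ≤ z * + d → ceiling (i ℚ./ d) ≤ z
  ceiling-/-≤ i d@(ℕ.suc _) z i≤zd = ceiling-≤ q z (cancel (gcd i (+ d)) (↥-/ i d) (↧-/ i d) (+≤+ ℕ.z≤n))
    where
    q = i ℚ./ d
    cancel : ∀ g → ↥ q * g ≡ i → ↧ q * g ≡ + d → 0ℤ ≤ g → ↥ q ≤ z * ↧ q
    -- A zero gcd would force the denominator `d` to be zero.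
    cancel +0         _     ↧q≡ _ with () ← trans (sym (*-zeroʳ (↧ q))) ↧q≡
    cancel g@(+[1+ _ ]) ↥q≡ ↧q≡ _ = *-cancelʳ-≤-pos (↥ q) (z * ↧ q) g (begin
      ↥ q * g       ≡⟨ ↥q≡ ⟩
      i             ≤⟨ i≤zd ⟩
      z * + d       ≡⟨ cong (z *_) ↧q≡ ⟨
      z * (↧ q * g) ≡⟨ *-assoc z (↧ q) g ⟨
      z * ↧ q * g   ∎)
      where open ≤-Reasoning

  -- Over the integers the hypothesis becomes `w ≤ (e + 1 - r) d`, with a genuine difference, so the
  -- ceiling is at most `e + 1 - r`.
  ceiling-/-bound : ∀ w d r e .{{_ : ℕ.NonZero d}} → w ℕ.+ d ℕ.* r ℕ.≤ d ℕ.* ℕ.suc e →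
                    ceiling (+ w ℚ./ d) + + r - 1ℤ ≤ + e
  ceiling-/-bound w d r e w+dr≤ = begin
    ceiling (+ w ℚ./ d) + + r - 1ℤ  ≤⟨ +-monoˡ-≤ (- 1ℤ) (+-monoˡ-≤ (+ r) (ceiling-/-≤ (+ w) d (+ ℕ.suc e - + r) w≤)) ⟩
    (1ℤ + + e - + r) + + r - 1ℤ     ≡⟨ cancel (+ e) (+ r) ⟩
    + e ∎
    where
    open ≤-Reasoning
    cancel : ∀ e r → (1ℤ + e - r) + r - 1ℤ ≡ e
    cancel = solve-∀
    isolate : ∀ w d r → w ≡ (w + d * r) - d * r
    isolate = solve-∀
    factor : ∀ d r e → d * e - d * r ≡ (e - r) * d
    factor = solve-∀
    w≤ : + w ≤ (+ ℕ.suc e - + r) * + d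
    w≤ = begin
      + w                               ≡⟨ isolate (+ w) (+ d) (+ r) ⟩
      (+ w + + d * + r) - + d * + r     ≡⟨ cong (λ k → (+ w + k) - + d * + r) (pos-* d r) ⟨
      + (w ℕ.+ d ℕ.* r) - + d * + r     ≤⟨ +-monoˡ-≤ (- (+ d * + r)) (+≤+ w+dr≤) ⟩
      + (d ℕ.* ℕ.suc e) - + d * + r     ≡⟨ cong (_- + d * + r) (pos-* d (ℕ.suc e)) ⟩
      + d * + ℕ.suc e - + d * + r       ≡⟨ factor (+ d) (+ r) (+ ℕ.suc e) ⟩
      (+ ℕ.suc e - + r) * + d           ∎

open import Data.Fin using (Fin)
open import Data.Integer using (+_; _+_; _-_; _≥_; 1ℤ)
open import Data.Nat as ℕ using (ℕ; _∸_)
open import Data.Rational using (_/_; ceiling)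
open import Relation.Binary.PropositionalEquality using (_≢_)

theorem2p10 : ∀ (n r : ℕ) (n≥3 : n ℕ.≥ 3) (G : Graph n) (χ : Colouring G r) (f : PairFunction n) →
    (∀ (u v : Fin n) → u ≢ v → HasDisjointMonoSuperPaths G χ (f ⟨ u , v ⟩) u v) →
    + edgeCount G ≥ ceiling (_/_ (+ weight f) (n ∸ 2) {{n∸2-nonZero n≥3}}) + + r - 1ℤ
theorem2p10 n r n≥3 G χ f paths =
  Ceiling.ceiling-/-bound (weight f) (n ∸ 2) r (edgeCount G) {{n∸2-nonZero n≥3}} (Counting.weight-bound G χ f paths)
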